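{- Let $k$ and $n$ be integers with $k\ge2$ even and $n\ge\max\{3,\frac{k^2}{4}+1\}$. Then \[{\rm bal}(n,K_{1,k})=\left(\frac{k-2}{2}\right)n-\frac{k^2}{8}+\frac k4,\] and ${\rm Bal}(n,K_{1,k})$ contains only one graph, namely the complete $(\frac{k-2}{2},\,n-\frac{k-2}{2})$-split graph.
   Context: $K_{1,k}$ is the star with $k$ edges. A complete $(p,q)$-split graph is a graph whose vertex set has a partition $X\cup Y$ with $|X|=p$, $|Y|=q$, $X$ inducing a complete graph $K_p$, $Y$ independent, and all edges between $X$ and $Y$ present (for $p=0$ it is the edgeless graph on $q$ vertices). A $2$-coloring $E(K_n)=E(R)\cup E(B)$ is a partition of the edges of $K_n$ into red and blue edges, forming the spanning subgraphs $R$ and $B$; $e(\cdot)$ denotes number of edges. For a graph $G$ with $e(G)$ even, a balanced copy of $G$ is a (not necessarily induced) subgraph of $K_n$ isomorphic to $G$ with exactly $e(G)/2$ red and $e(G)/2$ blue edges. ${\rm bal}(n,G)$ is the minimum non-negative integer $s$ such that every $2$-coloring $E(K_n)=E(R)\cup E(B)$ with $\min\{e(R),e(B)\}>s$ contains a balanced copy of $G$. ${\rm Bal}(n,G)$ is the family (up to isomorphism) of $n$-vertex graphs with exactly ${\rm bal}(n,G)$ edges such that a coloring $E(K_n)=E(R)\cup E(B)$ with $\min\{e(R),e(B)\}={\rm bal}(n,G)$ contains no balanced copy of $G$ if and only if $R$ or $B$ is isomorphic to some $H\in{\rm Bal}(n,G)$. -}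

module Defs where

import Algebra.Properties.CommutativeMonoid.Sum as Sum
open import Data.Bool using (Bool; true; false; not; _∧_; if_then_else_)
open import Data.Fin using (Fin; zero; suc; _<?_)
open import Data.Fin.Permutation using (Permutation′; _⟨$⟩ʳ_)
open import Data.Fin.Subset using (Subset; _∈_; _∪_; _∩_; ∣_∣; ⊤; ⊥)
open import Data.Nat using (ℕ; suc; _*_; _≤_; _<_; _⊓_)
open import Data.Nat.Properties using (+-0-commutativeMonoid)
open import Data.Product using (Σ-syntax; ∃-syntax; _×_)
open import Data.Sum using (_⊎_)
open import Function.Bundles using (_⇔_; _↣_; module Injection)
open import Level using (0ℓ)
open import Relation.Binary.PropositionalEquality using (_≡_; _≢_; refl)
open import Relation.Nullary using (¬_; ⌊_⌋)
open import Relation.Unary using (Pred)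

open Sum +-0-commutativeMonoid
  using () renaming (sum to sumℕ)

record Graph (n : ℕ) : Set where
  field
    adj    : Fin n → Fin n → Bool
    sym    : ∀ i j → adj i j ≡ adj j i
    irrefl : ∀ i → adj i i ≡ false

open Graph public using (adj)

-- Each unordered pair {i , j} is counted once, as i < j.
countPairs : ∀ {n} → (Fin n → Fin n → Bool) → ℕ
countPairs P =
  sumℕ λ i → sumℕ λ j → if ⌊ i <? j ⌋ ∧ P i j then 1 else 0

e : ∀ {n} → Graph n → ℕ
e G = countPairs (adj G)

infix 4 _≅_

_≅_ : ∀ {n} → Graph n → Graph n → Set
_≅_ {n} G H =
  Σ[ π ∈ Permutation′ n ] ∀ i j → adj G i j ≡ adj H (π ⟨$⟩ʳ i) (π ⟨$⟩ʳ j)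

-- The star K_{1,k}; its centre is vertex zero.
star : ∀ k → Graph (suc k)
star k = record { adj = a ; sym = s ; irrefl = r }
  where
  a : Fin (suc k) → Fin (suc k) → Bool
  a zero    zero    = false
  a zero    (suc _) = true
  a (suc _) zero    = true
  a (suc _) (suc _) = false

  s : ∀ i j → a i j ≡ a j i
  s zero    zero    = refl
  s zero    (suc _) = refl
  s (suc _) zero    = refl
  s (suc _) (suc _) = refl

  r : ∀ i → a i i ≡ false
  r zero    = refl
  r (suc _) = refl

record IsCompleteSplit {n : ℕ} (p q : ℕ) (G : Graph n) : Set where
  field
    X Y         : Subset n
    covering    : X ∪ Y ≡ ⊤
    disjoint    : X ∩ Y ≡ ⊥
    ∣X∣≡p       : ∣ X ∣ ≡ p
    ∣Y∣≡q       : ∣ Y ∣ ≡ q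
    clique      : ∀ i j → i ∈ X → j ∈ X → i ≢ j → adj G i j ≡ true
    independent : ∀ i j → i ∈ Y → j ∈ Y → adj G i j ≡ false
    joined      : ∀ i j → i ∈ X → j ∈ Y → adj G i j ≡ true

record Coloring (n : ℕ) : Set where
  field
    R B       : Graph n
    partition : ∀ i j → i ≢ j → adj B i j ≡ not (adj R i j)

open Coloring public using (R; B)

minColor : ∀ {n} → Coloring n → ℕ
minColor χ = e (R χ) ⊓ e (B χ)

-- The number of edges of the copy of G under f that lie in the graph H.
edgesIn : ∀ {v n} → Graph v → Graph n → (Fin v → Fin n) → ℕ
edgesIn G H f = countPairs λ i j → adj G i j ∧ adj H (f i) (f j)

-- A subgraph of K_n isomorphic to G is the image of an injection of the
-- vertices of G.  "Exactly e(G)/2" is stated without truncated division,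
-- so there is no balanced copy when e(G) is odd.
record BalancedCopy {v n : ℕ} (G : Graph v) (χ : Coloring n) : Set where
  field
    embedding : Fin v ↣ Fin n
  open Injection embedding using (to)
  field
    halfRed  : 2 * edgesIn G (R χ) to ≡ e G
    halfBlue : 2 * edgesIn G (B χ) to ≡ e G

ForcesBalanced : ∀ {v} → ℕ → Graph v → ℕ → Set
ForcesBalanced n G s = (χ : Coloring n) → s < minColor χ → BalancedCopy G χ

-- IsBal n G b says that b = bal(n,G).
IsBal : ∀ {v} → ℕ → Graph v → ℕ → Set
IsBal n G b =
  ForcesBalanced n G b × (∀ s → ForcesBalanced n G s → b ≤ s)

-- IsBalFamily G b F says that F = Bal(n,G), where b = bal(n,G).  A family
-- of graphs up to isomorphism is a predicate closed under isomorphism.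
record IsBalFamily {v n : ℕ} (G : Graph v) (b : ℕ) (F : Pred (Graph n) 0ℓ)
                   : Set where
  field
    closed        : ∀ H H′ → H ≅ H′ → F H → F H′
    size          : ∀ H → F H → e H ≡ b
    characterizes : (χ : Coloring n) → minColor χ ≡ b →
      (¬ BalancedCopy G χ) ⇔ (∃[ H ] F H × (R χ ≅ H ⊎ B χ ≅ H))

{-# OPTIONS --safe #-}

-- Write k = 2m and m = p + 1.  A colouring has no balanced K_{1,k} iff no vertex has both m red and
-- m blue edges.  Then the set C of vertices of red degree ≥ m has blue degrees ≤ p, its complement A
-- has red degrees ≤ p, and counting the edges between them gives |A| |C| ≤ p n; as n > m², one of the
-- sets, say C, has at most p elements.  Bounding the red degrees by n - 1 on C and by p on A gives
-- 2 e(R) ≤ p n + |C| (n - m) ≤ p n + p (n - m), and in case of equality |C| = p and all degree bounds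
-- are attained, which determines R as the split graph with clique C.  Conversely, the split graph has
-- fewer than half of all edges, so colouring it red attains the bound.
module Submission where

import Algebra.Properties.CommutativeMonoid.Sum as CMSum
import Algebra.Properties.Semiring.Sum as SRSum
open import Data.Bool using (Bool; true; false; not; _∧_; _∨_; if_then_else_)
open import Data.Bool.Properties using (∧-zeroʳ; ∧-identityʳ; ∨-comm; not-involutive)
open import Data.Empty using (⊥)
open import Data.Fin using (Fin; zero; suc; toℕ; fromℕ<; punchIn; punchOut; splitAt)
import Data.Fin as Fin
open import Data.Fin.Permutation as Perm using (Permutation′; _⟨$⟩ʳ_; _⟨$⟩ˡ_; _∘ₚ_)
import Data.Fin.Properties as Finₚ
open import Data.Fin.Properties using (toℕ-fromℕ<; punchIn-punchOut; punchOut-injective; any?)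
open import Data.Fin.Subset using (∁; ∣_∣) renaming (_∈_ to _∈ˢ_)
open import Data.Fin.Subset.Properties using (∪-inverseʳ; ∩-inverseʳ; ∣∁p∣≡n∸∣p∣)
import Data.Integer as ℤ
import Data.Integer.Properties as ℤₚ
import Data.Integer.Tactic.RingSolver as ℤ-RingSolver
open import Data.Nat using (_*_; _<_; zero; suc; z≤n; s≤s; s≤s⁻¹; _<ᵇ_; _⊓_; _≤?_; >-nonZero)
open import Data.Nat.Divisibility using (divides)
open import Data.Nat.DivMod using (m*n/n≡m)
open import Data.Nat.Properties
open import Data.Nat.Tactic.RingSolver using (solve-∀)
open import Data.Product using (_,_; proj₁; proj₂)
import Data.Rational.Properties as ℚₚ
open import Data.Rational.Unnormalised as ℚᵘ using (mkℚᵘ; *≡*)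
import Data.Rational.Unnormalised.Properties as ℚᵘₚ
open import Data.Sum using (_⊎_; inj₁; inj₂; [_,_]′; map)
open import Data.Vec using (lookup; tabulate)
open import Data.Vec.Properties using (lookup∘tabulate; []=⇒lookup; tabulate-∘)
open import Function using (_∘_; id; Injective; mk↣; mk⇔; Injection)
open import Relation.Binary.Definitions using (tri<; tri≈; tri>)
open import Relation.Binary.PropositionalEquality
  using (refl; sym; trans; cong; cong₂; subst; _≢_; _≗_; module ≡-Reasoning)
open import Relation.Nullary using (¬_; yes; no; does; _×-dec_; contradiction; ⌊_⌋)
open import Relation.Nullary.Decidable using (dec-true; dec-false; isYes≗does)

open import Defs
open import Data.Integer using (+_)
open import Data.Nat using (ℕ; _+_; _∸_; _^_; _/_; _⊔_; _≤_; _≥_)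
open import Data.Nat.Divisibility using (_∣_)
open import Data.Product using (Σ-syntax; ∃-syntax; _×_)
open import Data.Rational as ℚ using (ℚ)
open import Function.Bundles using (_⇔_; module Equivalence)
open import Level using (0ℓ)
open import Relation.Binary.PropositionalEquality using (_≡_)
open import Relation.Unary using (Pred)

open CMSum +-0-commutativeMonoid
  using (sum; sum-syntax; sum-cong-≗; sum-remove; sum-permute; ∑-distrib-+; ∑-comm; sum-replicate-zero)
open SRSum +-*-semiring using (*-distribˡ-sum; *-distribʳ-sum)

-- Sums and counting

sum-const : ∀ n c → ∑[ i < n ] c ≡ n * c
sum-const zero    c = refl
sum-const (suc n) c = cong (_+_ c) (sum-const n c)

sum-mono-≤ : ∀ {n} {f g : Fin n → ℕ} → (∀ i → f i ≤ g i) → sum f ≤ sum g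
sum-mono-≤ {zero}  f≤g = z≤n
sum-mono-≤ {suc n} f≤g = +-mono-≤ (f≤g zero) (sum-mono-≤ (f≤g ∘ suc))

+-squeeze : ∀ {a b c d} → a ≤ c → b ≤ d → c + d ≤ a + b → a ≡ c × b ≡ d
+-squeeze {a} {b} {c} {d} a≤c b≤d c+d≤a+b =
    ≤-antisym a≤c (+-cancelʳ-≤ d c a (≤-trans c+d≤a+b (+-monoʳ-≤ a b≤d)))
  , ≤-antisym b≤d (+-cancelˡ-≤ c d b (≤-trans c+d≤a+b (+-monoˡ-≤ b a≤c)))

-- The rigidity used in the equality case: when the total of the bounds is reached, every single
-- bound is reached.
sum-squeeze : ∀ {n} {f g : Fin n → ℕ} → (∀ i → f i ≤ g i) → sum g ≤ sum f → f ≗ g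
sum-squeeze f≤g Σg≤Σf zero    = proj₁ (+-squeeze (f≤g zero) (sum-mono-≤ (f≤g ∘ suc)) Σg≤Σf)
sum-squeeze f≤g Σg≤Σf (suc i) =
  sum-squeeze (f≤g ∘ suc)
    (≤-reflexive (sym (proj₂ (+-squeeze (f≤g zero) (sum-mono-≤ (f≤g ∘ suc)) Σg≤Σf)))) i

-- Induction on `k`: the value `g zero` is removed from the index set, and injectivity lets the
-- remaining values be renumbered by `punchOut`. It bounds the number of edges at the centre of an
-- embedded star by a degree.
sum-injective-≤ : ∀ {k n} (t : Fin n → ℕ) {g : Fin k → Fin n} →
                  Injective _≡_ _≡_ g → sum (t ∘ g) ≤ sum t
sum-injective-≤ {zero}          t     g-inj = z≤n
sum-injective-≤ {suc k} {zero}  t {g} g-inj with () ← g zero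
sum-injective-≤ {suc k} {suc n} t {g} g-inj = begin
  t (g zero) + sum (λ j → t (g (suc j)))
    ≡⟨ cong (_+_ (t (g zero))) (sum-cong-≗ λ j → cong t (sym (punchIn-punchOut (g₀≢ j)))) ⟩
  t (g zero) + sum (λ j → t (punchIn (g zero) (g′ j)))
    ≤⟨ +-monoʳ-≤ (t (g zero)) (sum-injective-≤ (t ∘ punchIn (g zero)) g′-inj) ⟩
  t (g zero) + sum (t ∘ punchIn (g zero))
    ≡⟨ sum-remove t ⟨
  sum t ∎
  where
  open ≤-Reasoning
  g₀≢ : ∀ j → g zero ≢ g (suc j)
  g₀≢ j eq with () ← g-inj eq
  g′ : Fin k → Fin n
  g′ j = punchOut (g₀≢ j)
  g′-inj : Injective _≡_ _≡_ g′
  g′-inj {i} {j} eq = Finₚ.suc-injective (g-inj (punchOut-injective (g₀≢ i) (g₀≢ j) eq))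

sum-splitAt : ∀ m {n} (f : Fin m → ℕ) (g : Fin n → ℕ) →
              sum (λ i → [ f , g ]′ (splitAt m i)) ≡ sum f + sum g
sum-splitAt zero    f g = refl
sum-splitAt (suc m) f g = trans
  (cong (_+_ (f zero)) (trans (sum-cong-≗ shift) (sum-splitAt m (f ∘ suc) g)))
  (sym (+-assoc (f zero) _ _))
  where
  shift : ∀ i → [ f , g ]′ (splitAt (suc m) (suc i)) ≡ [ f ∘ suc , g ]′ (splitAt m i)
  shift i with splitAt m i
  ... | inj₁ _ = refl
  ... | inj₂ _ = refl

𝟙 : Bool → ℕ
𝟙 b = if b then 1 else 0

𝟙≤1 : ∀ b → 𝟙 b ≤ 1
𝟙≤1 false = z≤n
𝟙≤1 true  = ≤-refl

𝟙-injective : ∀ a b → 𝟙 a ≡ 𝟙 b → a ≡ b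
𝟙-injective false false _ = refl
𝟙-injective true  true  _ = refl

count : ∀ {n} → (Fin n → Bool) → ℕ
count P = sum (𝟙 ∘ P)

count-false : ∀ n → count {n} (λ _ → false) ≡ 0
count-false = sum-replicate-zero

count-not : ∀ {n} (P : Fin n → Bool) → count P + count (not ∘ P) ≡ n
count-not {n} P = begin
  count P + count (not ∘ P)            ≡⟨ ∑-distrib-+ (𝟙 ∘ P) (𝟙 ∘ not ∘ P) ⟨
  ∑[ i < n ] (𝟙 (P i) + 𝟙 (not (P i))) ≡⟨ sum-cong-≗ (λ i → one (P i)) ⟩
  ∑[ i < n ] 1                         ≡⟨ sum-const n 1 ⟩
  n * 1                                ≡⟨ *-identityʳ n ⟩
  n                                    ∎
  where
  open ≡-Reasoning
  one : ∀ b → 𝟙 b + 𝟙 (not b) ≡ 1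
  one false = refl
  one true  = refl

count-singleton : ∀ {n} (v : Fin n) → count (λ w → does (v Fin.≟ w)) ≡ 1
count-singleton {suc n} zero    = cong suc (count-false n)
count-singleton {suc n} (suc v) = count-singleton v

count-others : ∀ {n} (v : Fin (suc n)) → count (λ w → not (does (v Fin.≟ w))) ≡ n
count-others v = suc-injective (trans
  (cong (_+ count (λ w → not (does (v Fin.≟ w)))) (sym (count-singleton v)))
  (count-not (λ w → does (v Fin.≟ w))))

count-initial : ∀ {p n} → p ≤ n → count {n} (λ i → toℕ i <ᵇ p) ≡ p
count-initial {n = n} z≤n = count-false n
count-initial (s≤s p≤n)   = cong suc (count-initial p≤n)

count≤n : ∀ {n} (P : Fin n → Bool) → count P ≤ n
count≤n {n} P = ≤-trans (m≤m+n _ _) (≤-reflexive (count-not P))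

-- A greedy scan keeps the first `m` indices that satisfy `P`; these become the leaves of one color
-- in a star.
select : ∀ {n m} (P : Fin n → Bool) → m ≤ count P →
         Σ[ g ∈ (Fin m → Fin n) ] Injective _≡_ _≡_ g × (∀ i → P (g i) ≡ true)
select {n} {zero} P _ = (λ ()) , (λ { {()} }) , λ ()
select {suc n} {suc m} P m≤ with P zero in P₀
... | true  = g′ , g′-inj , P-g′
  where
  rest = select (P ∘ suc) (s≤s⁻¹ m≤)
  g′ : Fin (suc m) → Fin (suc n)
  g′ zero    = zero
  g′ (suc i) = suc (proj₁ rest i)
  g′-inj : Injective _≡_ _≡_ g′
  g′-inj {zero}  {zero}  _  = refl
  g′-inj {suc i} {suc j} eq = cong suc (proj₁ (proj₂ rest) (Finₚ.suc-injective eq))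
  P-g′ : ∀ i → P (g′ i) ≡ true
  P-g′ zero    = P₀
  P-g′ (suc i) = proj₂ (proj₂ rest) i
... | false = let g , g-inj , Pg = select (P ∘ suc) m≤
              in suc ∘ g , (g-inj ∘ Finₚ.suc-injective) , Pg

-- `punchIn q` fixes the values below `q` and raises the others by one, so no value crosses the
-- threshold `q`. In the next lemma the skipped value `q` itself falls below the threshold.
punchIn-<ᵇ : ∀ {n} (q : Fin (suc n)) (x : Fin n) → (toℕ x <ᵇ toℕ q) ≡ (toℕ (punchIn q x) <ᵇ toℕ q)
punchIn-<ᵇ zero    x       = refl
punchIn-<ᵇ (suc q) zero    = refl
punchIn-<ᵇ (suc q) (suc x) = punchIn-<ᵇ q x

punchIn-<ᵇ-suc : ∀ {n} (q : Fin (suc n)) (x : Fin n) → (toℕ x <ᵇ toℕ q) ≡ (toℕ (punchIn q x) <ᵇ suc (toℕ q))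
punchIn-<ᵇ-suc zero    x       = refl
punchIn-<ᵇ-suc (suc q) zero    = refl
punchIn-<ᵇ-suc (suc q) (suc x) = punchIn-<ᵇ-suc q x

<ᵇ-irrefl : ∀ m → (m <ᵇ m) ≡ false
<ᵇ-irrefl zero    = refl
<ᵇ-irrefl (suc m) = <ᵇ-irrefl m

<ᵇ-suc : ∀ m → (m <ᵇ suc m) ≡ true
<ᵇ-suc zero    = refl
<ᵇ-suc (suc m) = <ᵇ-suc m

-- By induction the tail is sorted, and index `zero` is inserted at the boundary between its true
-- and false blocks. It then ends the first block or begins the second, according to `c zero`.
sortingPermutation : ∀ {n} (c : Fin n → Bool) →
  Σ[ π ∈ Permutation′ n ] ∀ i → c i ≡ (toℕ (π ⟨$⟩ʳ i) <ᵇ count c)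
sortingPermutation {zero}  c = Perm.id , λ ()
sortingPermutation {suc n} c with sortingPermutation (c ∘ suc)
... | π , π-sorts = Perm.insert zero q π , sorts
  where
  r = count (c ∘ suc)
  q : Fin (suc n)
  q = fromℕ< (s≤s (count≤n (c ∘ suc)))
  q≡r : toℕ q ≡ r
  q≡r = toℕ-fromℕ< _
  at-zero : ∀ b → b ≡ (toℕ q <ᵇ 𝟙 b + r)
  at-zero false = sym (trans (cong (_<ᵇ r) q≡r) (<ᵇ-irrefl r))
  at-zero true  = sym (trans (cong (_<ᵇ suc r) q≡r) (<ᵇ-suc r))
  at-suc : ∀ b x → (toℕ x <ᵇ r) ≡ (toℕ (punchIn q x) <ᵇ 𝟙 b + r)
  at-suc false x = subst (λ s → (toℕ x <ᵇ s) ≡ (toℕ (punchIn q x) <ᵇ s)) q≡r (punchIn-<ᵇ q x)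
  at-suc true  x = subst (λ s → (toℕ x <ᵇ s) ≡ (toℕ (punchIn q x) <ᵇ suc s)) q≡r (punchIn-<ᵇ-suc q x)
  sorts : ∀ i → c i ≡ (toℕ (Perm.insert zero q π ⟨$⟩ʳ i) <ᵇ count c)
  sorts zero    = at-zero (c zero)
  sorts (suc i) = trans (π-sorts i) (at-suc (c zero) (π ⟨$⟩ʳ i))

-- Degrees and isomorphisms

≅-refl : ∀ {n} (G : Graph n) → G ≅ G
≅-refl G = Perm.id , λ _ _ → refl

≅-sym : ∀ {n} (G H : Graph n) → G ≅ H → H ≅ G
≅-sym G H (π , h) = Perm.flip π , λ i j → sym (trans
  (h (π ⟨$⟩ˡ i) (π ⟨$⟩ˡ j)) (cong₂ (adj H) (Perm.inverseʳ π) (Perm.inverseʳ π)))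

≅-trans : ∀ {n} (G H K : Graph n) → G ≅ H → H ≅ K → G ≅ K
≅-trans G H K (π , h) (ρ , h′) = π ∘ₚ ρ , λ i j → trans (h i j) (h′ _ _)

deg : ∀ {n} → Graph n → Fin n → ℕ
deg G v = count (adj G v)

deg-≅ : ∀ {n} (G H : Graph n) (iso : G ≅ H) → ∀ v → deg G v ≡ deg H (proj₁ iso ⟨$⟩ʳ v)
deg-≅ G H (π , h) v = trans
  (sum-cong-≗ λ j → cong 𝟙 (h v j))
  (sym (sum-permute (𝟙 ∘ adj H (π ⟨$⟩ʳ v)) π))

-- One copy of `e G` is transposed, so that row `i` collects the neighbors above `i` from one copy
-- and those below `i` from the other. The diagonal contributes nothing, by irreflexivity.
handshake : ∀ {n} (G : Graph n) → 2 * e G ≡ sum (deg G)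
handshake {n} G = begin
  2 * e G
    ≡⟨ cong (_+_ (e G)) (+-identityʳ (e G)) ⟩
  e G + e G
    ≡⟨ cong (_+_ (e G)) (∑-comm below) ⟩
  e G + ∑[ i < n ] ∑[ j < n ] below j i
    ≡⟨ ∑-distrib-+ (λ i → sum (below i)) (λ i → ∑[ j < n ] below j i) ⟨
  ∑[ i < n ] (sum (below i) + ∑[ j < n ] below j i)
    ≡⟨ sum-cong-≗ (λ i → sym (∑-distrib-+ (below i) (λ j → below j i))) ⟩
  ∑[ i < n ] ∑[ j < n ] (below i j + below j i)
    ≡⟨ sum-cong-≗ (λ i → sum-cong-≗ (split-pair i)) ⟩
  sum (deg G) ∎
  where
  open ≡-Reasoning
  below : Fin n → Fin n → ℕ
  below i j = 𝟙 (⌊ i Fin.<? j ⌋ ∧ adj G i j)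
  is : ∀ i j → ⌊ i Fin.<? j ⌋ ≡ does (i Fin.<? j)
  is i j = isYes≗does (i Fin.<? j)
  split-pair : ∀ i j → below i j + below j i ≡ 𝟙 (adj G i j)
  split-pair i j rewrite is i j | is j i with Finₚ.<-cmp i j
  ... | tri< i<j _ j≮i rewrite dec-true (i Fin.<? j) i<j | dec-false (j Fin.<? i) j≮i = +-identityʳ _
  ... | tri> i≮j _ j<i rewrite dec-false (i Fin.<? j) i≮j | dec-true (j Fin.<? i) j<i = cong 𝟙 (Graph.sym G j i)
  ... | tri≈ i≮i refl _ rewrite dec-false (i Fin.<? i) i≮i | Graph.irrefl G i = refl

-- `e` counts pairs with `i < j`, an order that `π` need not respect. The degree sum is free of this
-- order, so the comparison passes through `handshake`.
e-≅ : ∀ {n} (G H : Graph n) → G ≅ H → e G ≡ e H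
e-≅ G H iso@(π , _) = *-cancelˡ-≡ _ _ 2 (begin
  2 * e G                     ≡⟨ handshake G ⟩
  sum (deg G)                 ≡⟨ sum-cong-≗ (deg-≅ G H iso) ⟩
  sum (deg H ∘ (π ⟨$⟩ʳ_))     ≡⟨ sum-permute (deg H) π ⟨
  sum (deg H)                 ≡⟨ handshake H ⟨
  2 * e H                     ∎)
  where open ≡-Reasoning

deg-R+B : ∀ {n} (χ : Coloring (suc n)) v → deg (R χ) v + deg (B χ) v ≡ n
deg-R+B {n} χ v = begin
  deg (R χ) v + deg (B χ) v                            ≡⟨ ∑-distrib-+ (𝟙 ∘ adj (R χ) v) (𝟙 ∘ adj (B χ) v) ⟨
  sum (λ w → 𝟙 (adj (R χ) v w) + 𝟙 (adj (B χ) v w))    ≡⟨ sum-cong-≗ pair ⟩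
  count (λ w → not (does (v Fin.≟ w)))                 ≡⟨ count-others v ⟩
  n                                                    ∎
  where
  open ≡-Reasoning
  pair : ∀ w → 𝟙 (adj (R χ) v w) + 𝟙 (adj (B χ) v w) ≡ 𝟙 (not (does (v Fin.≟ w)))
  pair w with v Fin.≟ w
  ... | yes refl rewrite Graph.irrefl (R χ) v | Graph.irrefl (B χ) v = refl
  ... | no v≢w rewrite Coloring.partition χ v w v≢w with adj (R χ) v w
  ...   | true  = refl
  ...   | false = refl

size-R+B : ∀ {n} (χ : Coloring (suc n)) → 2 * (e (R χ) + e (B χ)) ≡ suc n * n
size-R+B {n} χ = begin
  2 * (e (R χ) + e (B χ))                    ≡⟨ *-distribˡ-+ 2 (e (R χ)) _ ⟩
  2 * e (R χ) + 2 * e (B χ)                  ≡⟨ cong₂ _+_ (handshake (R χ)) (handshake (B χ)) ⟩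
  sum (deg (R χ)) + sum (deg (B χ))          ≡⟨ ∑-distrib-+ (deg (R χ)) (deg (B χ)) ⟨
  sum (λ v → deg (R χ) v + deg (B χ) v)      ≡⟨ sum-cong-≗ (deg-R+B χ) ⟩
  ∑[ i < suc n ] n                           ≡⟨ sum-const (suc n) n ⟩
  suc n * n                                  ∎
  where open ≡-Reasoning

swapColors : ∀ {n} → Coloring n → Coloring n
swapColors χ = record
  { R = B χ ; B = R χ
  ; partition = λ i j i≢j → sym (trans (cong not (Coloring.partition χ i j i≢j)) (not-involutive _)) }

≟-comm : ∀ {n} (i j : Fin n) → does (i Fin.≟ j) ≡ does (j Fin.≟ i)
≟-comm zero    zero    = refl
≟-comm zero    (suc _) = refl
≟-comm (suc _) zero    = refl
≟-comm (suc i) (suc j) = ≟-comm i j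

≟-refl : ∀ {n} (i : Fin n) → does (i Fin.≟ i) ≡ true
≟-refl i = dec-true (i Fin.≟ i) refl

complement : ∀ {n} → Graph n → Graph n
complement G = record
  { adj    = λ i j → not (does (i Fin.≟ j)) ∧ not (adj G i j)
  ; sym    = λ i j → cong₂ _∧_ (cong not (≟-comm i j)) (cong not (Graph.sym G i j))
  ; irrefl = λ i → cong (λ b → not b ∧ _) (≟-refl i) }

redGraph : ∀ {n} → Graph n → Coloring n
redGraph G = record
  { R = G ; B = complement G
  ; partition = λ i j i≢j → cong (λ b → not b ∧ not (adj G i j)) (dec-false (i Fin.≟ j) i≢j) }

-- Split graphs

-- The complete split graph whose clique is the set where `c` is true: distinct vertices are
-- adjacent as soon as one of them lies in that set.
split : ∀ {n} → (Fin n → Bool) → Graph n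
split c = record
  { adj    = λ i j → not (does (i Fin.≟ j)) ∧ (c i ∨ c j)
  ; sym    = λ i j → cong₂ _∧_ (cong not (≟-comm i j)) (∨-comm (c i) (c j))
  ; irrefl = λ i → cong (λ b → not b ∧ _) (≟-refl i) }

does-≟-injective : ∀ {n} (π : Permutation′ n) i j →
                   does (i Fin.≟ j) ≡ does (π ⟨$⟩ʳ i Fin.≟ π ⟨$⟩ʳ j)
does-≟-injective π i j with i Fin.≟ j
... | yes refl = sym (≟-refl (π ⟨$⟩ʳ i))
... | no  i≢j  = sym (dec-false (π ⟨$⟩ʳ i Fin.≟ π ⟨$⟩ʳ j) λ eq →
  i≢j (trans (sym (Perm.inverseˡ π)) (trans (cong (π ⟨$⟩ˡ_) eq) (Perm.inverseˡ π))))

-- Sorting moves the clique to an initial segment, so a split graph depends only on the size of its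
-- clique up to isomorphism.
split-≅-initial : ∀ {n} (c : Fin n → Bool) → split c ≅ split (λ i → toℕ i <ᵇ count c)
split-≅-initial c with sortingPermutation c
... | π , sorts = π , λ i j →
  cong₂ (λ a b → not a ∧ b) (does-≟-injective π i j) (cong₂ _∨_ (sorts i) (sorts j))

count-tabulate : ∀ {n} (c : Fin n → Bool) → ∣ tabulate c ∣ ≡ count c
count-tabulate {zero}  c = refl
count-tabulate {suc n} c with c zero
... | true  = cong suc (count-tabulate (c ∘ suc))
... | false = count-tabulate (c ∘ suc)

split-isCompleteSplit : ∀ {n} (c : Fin n → Bool) → IsCompleteSplit (count c) (n ∸ count c) (split c)
split-isCompleteSplit {n} c = record
  { X = X₀ ; Y = ∁ X₀
  ; covering    = ∪-inverseʳ X₀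
  ; disjoint    = ∩-inverseʳ X₀
  ; ∣X∣≡p       = count-tabulate c
  ; ∣Y∣≡q       = trans (∣∁p∣≡n∸∣p∣ X₀) (cong (_∸_ n) (count-tabulate c))
  ; clique      = λ i j i∈X _ i≢j → adjacent i j i≢j (in-X i i∈X)
  ; independent = λ i j i∈Y j∈Y → trans
      (cong₂ (λ a b → not (does (i Fin.≟ j)) ∧ (a ∨ b)) (in-Y i i∈Y) (in-Y j j∈Y))
      (∧-zeroʳ _)
  ; joined      = λ i j i∈X j∈Y → adjacent i j (i≢j i∈X j∈Y) (in-X i i∈X) }
  where
  X₀ = tabulate c
  in-X : ∀ i → i ∈ˢ X₀ → c i ≡ true
  in-X i i∈X = trans (sym (lookup∘tabulate c i)) ([]=⇒lookup i∈X)
  in-Y : ∀ i → i ∈ˢ ∁ X₀ → c i ≡ false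
  in-Y i i∈Y = begin
    c i              ≡⟨ not-involutive (c i) ⟨
    not (not (c i))  ≡⟨ cong not (sym (lookup∘tabulate (not ∘ c) i)) ⟩
    not (lookup (tabulate (not ∘ c)) i)
      ≡⟨ cong not ([]=⇒lookup (subst (i ∈ˢ_) (sym (tabulate-∘ not c)) i∈Y)) ⟩
    false            ∎
    where open ≡-Reasoning
  i≢j : ∀ {i j} → i ∈ˢ X₀ → j ∈ˢ ∁ X₀ → i ≢ j
  i≢j {i} i∈X i∈Y refl with () ← trans (sym (in-X i i∈X)) (in-Y i i∈Y)
  adjacent : ∀ i j → i ≢ j → c i ≡ true → adj (split c) i j ≡ true
  adjacent i j i≢j ci = cong₂ (λ a b → not a ∧ (b ∨ c j)) (dec-false (i Fin.≟ j) i≢j) ci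

-- Balanced stars

-- A pair `i < j` containing the centre `zero` lies in row `zero`; all other rows concern two
-- leaves.
countPairs-star : ∀ {k} (P : Fin (suc k) → Fin (suc k) → Bool) → (∀ i j → P (suc i) (suc j) ≡ false) →
                  countPairs P ≡ count (P zero ∘ suc)
countPairs-star {k} P P-suc = trans
  (cong (_+_ (count (P zero ∘ suc))) (trans (sum-cong-≗ row) (sum-replicate-zero k)))
  (+-identityʳ _)
  where
  row : ∀ i → sum (λ j → 𝟙 (⌊ suc i Fin.<? j ⌋ ∧ P (suc i) j)) ≡ 0
  row i = trans
    -- The column of the centre vanishes by computation, which leaves the columns `suc j`.
    (sum-cong-≗ λ j → cong 𝟙 (trans (cong (⌊ suc i Fin.<? suc j ⌋ ∧_) (P-suc i j)) (∧-zeroʳ _)))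
    (count-false k)

e-star : ∀ k → e (star k) ≡ k
e-star k = trans (countPairs-star (adj (star k)) (λ _ _ → refl)) (trans (sum-const k 1) (*-identityʳ k))

edgesIn-star : ∀ {k n} (H : Graph n) (f : Fin (suc k) → Fin n) →
               edgesIn (star k) H f ≡ count (λ j → adj H (f zero) (f (suc j)))
edgesIn-star {k} H f = countPairs-star (λ i j → adj (star k) i j ∧ adj H (f i) (f j)) (λ _ _ → refl)

Unbalanced : ∀ {n} → ℕ → Coloring n → Set
Unbalanced m χ = ∀ v → ¬ (m ≤ deg (R χ) v × m ≤ deg (B χ) v)

2*m≡m+m : ∀ m → 2 * m ≡ m + m
2*m≡m+m m = cong (_+_ m) (+-identityʳ m)

adj⇒≢ : ∀ {n} (G : Graph n) {i j} → adj G i j ≡ true → i ≢ j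
adj⇒≢ G {i} ij refl with () ← trans (sym ij) (Graph.irrefl G i)

not-both : ∀ {n} (χ : Coloring n) {i j} → adj (R χ) i j ≡ true → adj (B χ) i j ≡ false
not-both χ {i} {j} ij = trans (Coloring.partition χ i j (adj⇒≢ (R χ) ij)) (cong not ij)

-- The first `m` leaves are red neighbors of `v` and the last `m` are blue ones. The two groups are
-- disjoint because no edge has both colors.
balancedStar : ∀ {m n} (χ : Coloring n) v → m ≤ deg (R χ) v → m ≤ deg (B χ) v →
               BalancedCopy (star (m + m)) χ
balancedStar {m} {n} χ v m≤R m≤B
  with select (adj (R χ) v) m≤R | select (adj (B χ) v) m≤B
... | r , r-inj , r-red | b , b-inj , b-blue = record
  { embedding = mk↣ f-inj
  ; halfRed   = half (R χ) (trans (split-sum (R χ))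
      (trans (cong₂ _+_ (all-true (R χ) r r-red) (all-false (R χ) b b-notRed)) (+-identityʳ m)))
  ; halfBlue  = half (B χ) (trans (split-sum (B χ))
      (cong₂ _+_ (all-false (B χ) r (not-both χ ∘ r-red)) (all-true (B χ) b b-blue))) }
  where
  leaf : Fin m ⊎ Fin m → Fin n
  leaf = [ r , b ]′
  f : Fin (suc (m + m)) → Fin n
  f zero    = v
  f (suc j) = leaf (splitAt m j)
  b-notRed : ∀ i → adj (R χ) v (b i) ≡ false
  b-notRed i = not-both (swapColors χ) (b-blue i)
  v≢leaf : ∀ x → v ≢ leaf x
  v≢leaf (inj₁ i) = adj⇒≢ (R χ) (r-red i)
  v≢leaf (inj₂ i) = adj⇒≢ (B χ) (b-blue i)
  r≢b : ∀ i j → r i ≢ b j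
  r≢b i j eq with () ← trans (sym (r-red i)) (trans (cong (adj (R χ) v) eq) (b-notRed j))
  leaf-inj : ∀ x y → leaf x ≡ leaf y → x ≡ y
  leaf-inj (inj₁ i) (inj₁ j) eq = cong inj₁ (r-inj eq)
  leaf-inj (inj₁ i) (inj₂ j) eq = contradiction eq (r≢b i j)
  leaf-inj (inj₂ i) (inj₁ j) eq = contradiction (sym eq) (r≢b j i)
  leaf-inj (inj₂ i) (inj₂ j) eq = cong inj₂ (b-inj eq)
  f-inj : Injective _≡_ _≡_ f
  f-inj {zero}  {zero}  _  = refl
  f-inj {zero}  {suc j} eq = contradiction eq (v≢leaf (splitAt m j))
  f-inj {suc i} {zero}  eq = contradiction (sym eq) (v≢leaf (splitAt m i))
  f-inj {suc i} {suc j} eq = cong suc (begin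
    i                              ≡⟨ Finₚ.join-splitAt m m i ⟨
    Fin.join m m (splitAt m i)     ≡⟨ cong (Fin.join m m) (leaf-inj (splitAt m i) (splitAt m j) eq) ⟩
    Fin.join m m (splitAt m j)     ≡⟨ Finₚ.join-splitAt m m j ⟩
    j                              ∎)
    where open ≡-Reasoning
  split-sum : ∀ H → count (λ j → adj H v (leaf (splitAt m j)))
                  ≡ count (adj H v ∘ r) + count (adj H v ∘ b)
  split-sum H = trans (sum-cong-≗ λ j → push (splitAt m j))
                      (sum-splitAt m (𝟙 ∘ adj H v ∘ r) (𝟙 ∘ adj H v ∘ b))
    where
    push : ∀ x → 𝟙 (adj H v (leaf x)) ≡ [ 𝟙 ∘ adj H v ∘ r , 𝟙 ∘ adj H v ∘ b ]′ x
    push (inj₁ _) = refl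
    push (inj₂ _) = refl
  all-true : ∀ H (g : Fin m → Fin n) → (∀ i → adj H v (g i) ≡ true) → count (adj H v ∘ g) ≡ m
  all-true H g t = trans (sum-cong-≗ (cong 𝟙 ∘ t)) (trans (sum-const m 1) (*-identityʳ m))
  all-false : ∀ H (g : Fin m → Fin n) → (∀ i → adj H v (g i) ≡ false) → count (adj H v ∘ g) ≡ 0
  all-false H g t = trans (sum-cong-≗ (cong 𝟙 ∘ t)) (count-false m)
  half : ∀ H → count (λ j → adj H v (leaf (splitAt m j))) ≡ m →
         2 * edgesIn (star (m + m)) H f ≡ e (star (m + m))
  half H eq = begin
    2 * edgesIn (star (m + m)) H f   ≡⟨ cong (2 *_) (trans (edgesIn-star H f) eq) ⟩
    2 * m                            ≡⟨ 2*m≡m+m m ⟩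
    m + m                            ≡⟨ e-star (m + m) ⟨
    e (star (m + m))                 ∎
    where open ≡-Reasoning

unbalanced⇒¬balancedStar : ∀ {m n} (χ : Coloring n) → Unbalanced m χ → ¬ BalancedCopy (star (m + m)) χ
unbalanced⇒¬balancedStar {m} {n} χ unbal copy =
  unbal (to zero) (enough (R χ) halfRed , enough (B χ) halfBlue)
  where
  open BalancedCopy copy
  open Injection embedding using (to; injective)
  enough : ∀ H → 2 * edgesIn (star (m + m)) H to ≡ e (star (m + m)) → m ≤ deg H (to zero)
  enough H half = begin
    m
      ≡⟨ *-cancelˡ-≡ _ _ 2 (trans half (trans (e-star (m + m)) (sym (2*m≡m+m m)))) ⟨
    edgesIn (star (m + m)) H to
      ≡⟨ edgesIn-star H to ⟩
    count (λ j → adj H (to zero) (to (suc j)))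
      ≤⟨ sum-injective-≤ (𝟙 ∘ adj H (to zero)) (Finₚ.suc-injective ∘ injective) ⟩
    deg H (to zero) ∎
    where open ≤-Reasoning

¬balancedStar⇒unbalanced : ∀ {m n} (χ : Coloring n) → ¬ BalancedCopy (star (m + m)) χ → Unbalanced m χ
¬balancedStar⇒unbalanced χ ¬copy v (m≤R , m≤B) = ¬copy (balancedStar χ v m≤R m≤B)

-- `ForcesBalanced` demands an actual copy, so a centre is found by a finite search rather than by
-- contradiction.
balancedStar⊎unbalanced : ∀ m {n} (χ : Coloring n) → BalancedCopy (star (m + m)) χ ⊎ Unbalanced m χ
balancedStar⊎unbalanced m χ with any? (λ v → (m ≤? deg (R χ) v) ×-dec (m ≤? deg (B χ) v))
... | yes (v , m≤R , m≤B) = inj₁ (balancedStar χ v m≤R m≤B)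
... | no  none            = inj₂ λ v both → none (v , both)

-- The extremal problem

m≤m*m : ∀ m → m ≤ m * m
m≤m*m zero    = z≤n
m≤m*m (suc m) = m≤m*n (suc m) (suc m)

-- Each pair between the two sides is charged to its endpoint in `c` if it is blue and to the other
-- endpoint if it is red. No vertex is then charged more than `p` times.
crossing : ∀ {n} p (χ : Coloring n) (c : Fin n → Bool) →
           (∀ v → c v ≡ false → deg (R χ) v ≤ p) → (∀ v → c v ≡ true → deg (B χ) v ≤ p) →
           count c * count (not ∘ c) ≤ n * p
crossing {n} p χ c R≤p B≤p = begin
  count c * count c̄
    ≡⟨ *-distribʳ-sum (count c̄) (𝟙 ∘ c) ⟩
  ∑[ v < n ] (𝟙 (c v) * count c̄)
    ≡⟨ sum-cong-≗ (λ v → *-distribˡ-sum (𝟙 (c v)) (𝟙 ∘ c̄)) ⟩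
  ∑[ v < n ] ∑[ w < n ] (𝟙 (c v) * 𝟙 (c̄ w))
    ≤⟨ sum-mono-≤ (λ v → sum-mono-≤ (colored v)) ⟩
  ∑[ v < n ] ∑[ w < n ] (blue v w + red w v)
    ≡⟨ sum-cong-≗ (λ v → ∑-distrib-+ (blue v) (λ w → red w v)) ⟩
  ∑[ v < n ] (sum (blue v) + ∑[ w < n ] red w v)
    ≡⟨ ∑-distrib-+ (λ v → sum (blue v)) (λ v → ∑[ w < n ] red w v) ⟩
  ∑[ v < n ] sum (blue v) + ∑[ v < n ] ∑[ w < n ] red w v
    ≡⟨ cong (_+_ (∑[ v < n ] sum (blue v))) (∑-comm (λ v w → red w v)) ⟩
  ∑[ v < n ] sum (blue v) + ∑[ w < n ] sum (red w)
    ≤⟨ +-mono-≤ (sum-mono-≤ blue≤) (sum-mono-≤ red≤) ⟩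
  ∑[ v < n ] (𝟙 (c v) * p) + ∑[ w < n ] (𝟙 (c̄ w) * p)
    ≡⟨ cong₂ _+_ (sym (*-distribʳ-sum p (𝟙 ∘ c))) (sym (*-distribʳ-sum p (𝟙 ∘ c̄))) ⟩
  count c * p + count c̄ * p
    ≡⟨ *-distribʳ-+ p (count c) (count c̄) ⟨
  (count c + count c̄) * p
    ≡⟨ cong (_* p) (count-not c) ⟩
  n * p ∎
  where
  open ≤-Reasoning
  c̄ = not ∘ c
  blue red : Fin n → Fin n → ℕ
  blue v w = 𝟙 (c v) * 𝟙 (adj (B χ) v w)
  red  w v = 𝟙 (c̄ w) * 𝟙 (adj (R χ) w v)
  colored : ∀ v w → 𝟙 (c v) * 𝟙 (c̄ w) ≤ blue v w + red w v
  colored v w with c v in cv | c w in cw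
  ... | false | _     = z≤n
  ... | true  | true  = z≤n
  -- The endpoints are distinct because `c` separates them, so the pair has exactly one color and
  -- exactly one summand pays for it.
  ... | true  | false
    rewrite Coloring.partition χ v w (λ { refl → contradiction (trans (sym cv) cw) λ () })
          | Graph.sym (R χ) v w with adj (R χ) w v
  ...   | true  = ≤-refl
  ...   | false = ≤-refl
  blue≤ : ∀ v → sum (blue v) ≤ 𝟙 (c v) * p
  blue≤ v = ≤-trans (≤-reflexive (sym (*-distribˡ-sum (𝟙 (c v)) (𝟙 ∘ adj (B χ) v)))) bound
    where
    bound : 𝟙 (c v) * deg (B χ) v ≤ 𝟙 (c v) * p
    bound with c v in cv
    ... | false = z≤n
    ... | true  = *-monoʳ-≤ 1 (B≤p v cv)
  red≤ : ∀ w → sum (red w) ≤ 𝟙 (c̄ w) * p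
  red≤ w = ≤-trans (≤-reflexive (sym (*-distribˡ-sum (𝟙 (c̄ w)) (𝟙 ∘ adj (R χ) w)))) bound
    where
    bound : 𝟙 (c̄ w) * deg (R χ) w ≤ 𝟙 (c̄ w) * p
    bound with c w in cw
    ... | true  = z≤n
    ... | false = *-monoʳ-≤ 1 (R≤p w cw)

⊓-≡ˡ : ∀ {a b s} → a ≡ s → s ≤ b → a ⊓ b ≡ s
⊓-≡ˡ refl a≤b = m≤n⇒m⊓n≡m a≤b

-- Here k = 2 (p + 1) and `d` stands for n - m, which avoids truncated subtraction. In these terms
-- `large` says n ≥ m² + 1.
module Extremal (p d : ℕ) (large : suc (p * p + p) ≤ d) where

  n m : ℕ
  n = suc (p + d)
  m = suc p

  d>0 : 0 < d
  d>0 = ≤-trans (s≤s z≤n) large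

  initial : Fin n → Bool
  initial i = toℕ i <ᵇ p

  count-initial≡p : count initial ≡ p
  count-initial≡p = count-initial (≤-trans (m≤m+n p d) (n≤1+n _))

  S : Graph n
  S = split initial

  -- For x = p + 1 + s and y = p + 1 + t the product bound reads (1 + s) (1 + t) ≤ p²,
  -- which forces x + y ≤ p² + 2 p + 1.
  one-side-small : ∀ x y → x + y ≡ n → x * y ≤ n * p → x ≤ p ⊎ y ≤ p
  one-side-small x y x+y≡n xy≤np with x ≤? p | y ≤? p
  ... | yes x≤p | _       = inj₁ x≤p
  ... | no  _   | yes y≤p = inj₂ y≤p
  ... | no  x≰p | no  y≰p
    with s , refl ← m≤n⇒∃[o]m+o≡n (≰⇒> x≰p) | t , refl ← m≤n⇒∃[o]m+o≡n (≰⇒> y≰p) =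
    contradiction too-large (<-irrefl refl)
    where
    open ≤-Reasoning
    product : ∀ p s t → (suc p + s) * (suc p + t) ≡ suc s * suc t + (p * p + (2 + s + t) * p)
    product = solve-∀
    total : ∀ p s t → (suc p + s + (suc p + t)) * p ≡ p * p + (p * p + (2 + s + t) * p)
    total = solve-∀
    lower : ∀ p → 1 + (p + (1 + (p * p + p))) ≡ 1 + (1 + (p + p) + p * p)
    lower = solve-∀
    upper : ∀ p s t → suc p + s + (suc p + t) ≡ 1 + (p + p) + (1 + (s + t))
    upper = solve-∀
    expand : ∀ s t → suc s * suc t ≡ 1 + (s + t) + s * t
    expand = solve-∀
    st≤pp : suc s * suc t ≤ p * p
    st≤pp = +-cancelʳ-≤ (p * p + (2 + s + t) * p) _ _ (begin
      suc s * suc t + (p * p + (2 + s + t) * p)   ≡⟨ product p s t ⟨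
      (suc p + s) * (suc p + t)                   ≤⟨ xy≤np ⟩
      n * p                                       ≡⟨ cong (_* p) x+y≡n ⟨
      (suc p + s + (suc p + t)) * p               ≡⟨ total p s t ⟩
      p * p + (p * p + (2 + s + t) * p)           ∎)
    too-large : suc (suc (p + p) + p * p) ≤ suc (p + p) + p * p
    too-large = begin
      suc (suc (p + p) + p * p)      ≡⟨ lower p ⟨
      suc (p + suc (p * p + p))      ≤⟨ s≤s (+-monoʳ-≤ p large) ⟩
      n                              ≡⟨ x+y≡n ⟨
      suc p + s + (suc p + t)        ≡⟨ upper p s t ⟩
      suc (p + p) + suc (s + t)      ≤⟨ +-monoʳ-≤ (suc (p + p)) (m≤m+n _ (s * t)) ⟩
      suc (p + p) + (suc (s + t) + s * t)   ≡⟨ cong (_+_ (suc (p + p))) (expand s t) ⟨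
      suc (p + p) + suc s * suc t    ≤⟨ +-monoʳ-≤ (suc (p + p)) st≤pp ⟩
      suc (p + p) + p * p            ∎

  DegreeBounded : Graph n → Set
  DegreeBounded G = Σ[ c ∈ (Fin n → Bool) ] count c ≤ p × (∀ v → deg G v ≤ p + 𝟙 (c v) * d)

  deg-bound : ∀ (χ : Coloring n) (c : Fin n → Bool) →
              (∀ v → c v ≡ false → deg (R χ) v ≤ p) → ∀ v → deg (R χ) v ≤ p + 𝟙 (c v) * d
  deg-bound χ c R≤p v with c v in cv
  ... | false = ≤-trans (R≤p v cv) (m≤m+n p 0)
  ... | true  = begin
    deg (R χ) v                  ≤⟨ m≤m+n _ _ ⟩
    deg (R χ) v + deg (B χ) v    ≡⟨ deg-R+B χ v ⟩
    p + d                        ≡⟨ cong (_+_ p) (+-identityʳ d) ⟨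
    p + 1 * d                    ∎
    where open ≤-Reasoning

  -- If the set of vertices of large red degree is the small side, it serves as the exceptional set
  -- for red. Otherwise its complement serves for blue, with the colors exchanged.
  unbalanced⇒degreeBounded : ∀ (χ : Coloring n) → Unbalanced m χ → DegreeBounded (R χ) ⊎ DegreeBounded (B χ)
  unbalanced⇒degreeBounded χ unbal = map
    (λ c≤p → c , c≤p , deg-bound χ c R≤p)
    (λ c̄≤p → not ∘ c , c̄≤p ,
      deg-bound (swapColors χ) (not ∘ c)
        (λ v c̄v → B≤p v (trans (sym (not-involutive (c v))) (cong not c̄v))))
    (one-side-small (count c) (count (not ∘ c)) (count-not c) (crossing p χ c R≤p B≤p))
    where
    c : Fin n → Bool
    c v = does (m ≤? deg (R χ) v)
    R≤p : ∀ v → c v ≡ false → deg (R χ) v ≤ p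
    R≤p v cv = s≤s⁻¹ (≰⇒> λ m≤R → contradiction (trans (sym cv) (dec-true (m ≤? deg (R χ) v) m≤R)) λ ())
    B≤p : ∀ v → c v ≡ true → deg (B χ) v ≤ p
    B≤p v cv = s≤s⁻¹ (≰⇒> λ m≤B →
      contradiction (trans (sym cv) (dec-false (m ≤? deg (R χ) v) λ m≤R → unbal v (m≤R , m≤B))) λ ())

  sum-bounds : ∀ (c : Fin n → Bool) → ∑[ v < n ] (p + 𝟙 (c v) * d) ≡ n * p + count c * d
  sum-bounds c = trans (∑-distrib-+ (λ _ → p) (λ v → 𝟙 (c v) * d))
    (cong₂ _+_ (sum-const n p) (sym (*-distribʳ-sum d (𝟙 ∘ c))))

  -- Split graphs with a clique of size `p` attain every bound in `DegreeBounded`, which yields the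
  -- size of `S`.
  deg-split : ∀ (c : Fin n → Bool) → count c ≡ p → ∀ v → deg (split c) v ≡ p + 𝟙 (c v) * d
  deg-split c c≡p v with c v in cv
  ... | true  = trans
    (sum-cong-≗ λ w → cong 𝟙 (∧-identityʳ (not (does (v Fin.≟ w)))))
    (trans (count-others v) (cong (_+_ p) (sym (+-identityʳ d))))
  ... | false = trans (sum-cong-≗ row) (trans c≡p (sym (+-identityʳ p)))
    where
    row : ∀ w → 𝟙 (not (does (v Fin.≟ w)) ∧ c w) ≡ 𝟙 (c w)
    row w with v Fin.≟ w
    ... | yes refl = cong 𝟙 (sym cv)
    ... | no _     = refl

  2*e[S] : 2 * e S ≡ n * p + p * d
  2*e[S] = trans (handshake S) (trans (sum-cong-≗ (deg-split initial count-initial≡p))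
    (trans (sum-bounds initial) (cong (λ x → n * p + x * d) count-initial≡p)))

  degreeBounded⇒size≤ : ∀ G → DegreeBounded G → e G ≤ e S
  degreeBounded⇒size≤ G (c , c≤p , deg≤) = *-cancelˡ-≤ 2 (begin
    2 * e G                          ≡⟨ handshake G ⟩
    sum (deg G)                      ≤⟨ sum-mono-≤ deg≤ ⟩
    ∑[ v < n ] (p + 𝟙 (c v) * d)     ≡⟨ sum-bounds c ⟩
    n * p + count c * d              ≤⟨ +-monoʳ-≤ (n * p) (*-monoˡ-≤ d c≤p) ⟩
    n * p + p * d                    ≡⟨ 2*e[S] ⟨
    2 * e S                          ∎)
    where open ≤-Reasoning

  split-≅ : ∀ (c : Fin n → Bool) → count c ≡ p → split c ≅ S
  split-≅ c c≡p = subst (λ x → split c ≅ split (λ i → toℕ i <ᵇ x)) c≡p (split-≅-initial c)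

  extremal⇒≅ : ∀ G → DegreeBounded G → e S ≤ e G → G ≅ S
  extremal⇒≅ G (c , c≤p , deg≤) eS≤eG = ≅-trans G (split c) S (Perm.id , is-split) (split-≅ c c≡p)
    where
    open ≤-Reasoning
    sum≥ : n * p + p * d ≤ sum (deg G)
    sum≥ = begin
      n * p + p * d   ≡⟨ 2*e[S] ⟨
      2 * e S         ≤⟨ *-monoʳ-≤ 2 eS≤eG ⟩
      2 * e G         ≡⟨ handshake G ⟩
      sum (deg G)     ∎
    -- The sizes compare `p * d` with `count c * d`, and `d` is positive, so it cancels.
    c≡p : count c ≡ p
    c≡p = ≤-antisym c≤p (*-cancelʳ-≤ p (count c) d ⦃ >-nonZero d>0 ⦄ (+-cancelˡ-≤ (n * p) _ _ (begin
      n * p + p * d                  ≤⟨ sum≥ ⟩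
      sum (deg G)                    ≤⟨ sum-mono-≤ deg≤ ⟩
      ∑[ v < n ] (p + 𝟙 (c v) * d)   ≡⟨ sum-bounds c ⟩
      n * p + count c * d            ∎)))
    deg≡ : ∀ v → deg G v ≡ p + 𝟙 (c v) * d
    deg≡ = sum-squeeze deg≤ (begin
      ∑[ v < n ] (p + 𝟙 (c v) * d)   ≡⟨ sum-bounds c ⟩
      n * p + count c * d            ≤⟨ +-monoʳ-≤ (n * p) (*-monoˡ-≤ d c≤p) ⟩
      n * p + p * d                  ≤⟨ sum≥ ⟩
      sum (deg G)                    ∎)
    -- A vertex of the clique has degree p + d = n - 1, so it misses no other vertex.
    full : ∀ v → c v ≡ true → ∀ w → adj G v w ≡ not (does (v Fin.≟ w))
    full v cv w = 𝟙-injective _ _ (sum-squeeze below (≤-reflexive (begin-equality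
      count (λ w → not (does (v Fin.≟ w)))   ≡⟨ count-others v ⟩
      p + d                                  ≡⟨ cong (_+_ p) (+-identityʳ d) ⟨
      p + 1 * d                              ≡⟨ cong (λ b → p + 𝟙 b * d) cv ⟨
      p + 𝟙 (c v) * d                        ≡⟨ deg≡ v ⟨
      deg G v                                ∎)) w)
      where
      below : ∀ w → 𝟙 (adj G v w) ≤ 𝟙 (not (does (v Fin.≟ w)))
      below w with v Fin.≟ w
      ... | yes refl = ≤-reflexive (cong 𝟙 (Graph.irrefl G v))
      ... | no _     = 𝟙≤1 _
    -- By `full`, a vertex outside `c` is adjacent to all of `c`. As its degree is p = `count c`, it
    -- has no further neighbors.
    only-c : ∀ v → c v ≡ false → ∀ w → c w ≡ adj G v w
    only-c v cv w = 𝟙-injective _ _ (sum-squeeze below (≤-reflexive (begin-equality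
      deg G v           ≡⟨ deg≡ v ⟩
      p + 𝟙 (c v) * d   ≡⟨ cong (λ b → p + 𝟙 b * d) cv ⟩
      p + 0             ≡⟨ +-identityʳ p ⟩
      p                 ≡⟨ c≡p ⟨
      count c           ∎)) w)
      where
      below : ∀ w → 𝟙 (c w) ≤ 𝟙 (adj G v w)
      below w with c w in cw
      ... | false = z≤n
      ... | true  = ≤-reflexive (cong 𝟙 (sym (trans (Graph.sym G v w) (trans (full w cw v)
                      (cong not (dec-false (w Fin.≟ v) λ { refl → contradiction (trans (sym cv) cw) λ () }))))))
    is-split : ∀ v w → adj G v w ≡ adj (split c) v w
    is-split v w with c v in cv
    ... | true  = trans (full v cv w) (sym (∧-identityʳ _))
    ... | false with v Fin.≟ w
    ...   | yes refl = Graph.irrefl G v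
    ...   | no _     = sym (only-c v cv w)

  -- The left side is 4 e(S) and the right side is n (n - 1), so `S` has fewer than half of all
  -- edges.
  twice-bound<pairs : 2 * (n * p + p * d) < n * (p + d)
  twice-bound<pairs = begin-strict
    2 * (n * p + p * d)                                  ≡⟨ lhs p d ⟩
    (p + p * p + 2 * p * d) + (p * p + p + 2 * p * d)
      -- Beyond the common part, p² + p < d is `large`, and 2 p d ≤ d² follows from 2 p ≤ p² + p <
      -- d.
      <⟨ +-monoʳ-< (p + p * p + 2 * p * d) (+-mono-<-≤ large (*-monoˡ-≤ d 2p≤d)) ⟩
    (p + p * p + 2 * p * d) + (d + d * d)                ≡⟨ rhs p d ⟨
    n * (p + d)                                          ∎
    where
    open ≤-Reasoning
    lhs : ∀ p d → 2 * ((1 + (p + d)) * p + p * d) ≡ (p + p * p + 2 * p * d) + (p * p + p + 2 * p * d)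
    lhs = solve-∀
    rhs : ∀ p d → (1 + (p + d)) * (p + d) ≡ (p + p * p + 2 * p * d) + (d + d * d)
    rhs = solve-∀
    2p≤d : 2 * p ≤ d
    2p≤d = begin
      2 * p               ≡⟨ 2*m≡m+m p ⟩
      p + p               ≤⟨ +-monoˡ-≤ p (m≤m*m p) ⟩
      p * p + p           ≤⟨ n≤1+n _ ⟩
      suc (p * p + p)     ≤⟨ large ⟩
      d                   ∎

  -- Hence a color class with e(S) edges realizes `minColor`. The strictness also keeps the other
  -- class from having that size, which the uniqueness of the family relies on.
  e[S]<other : ∀ (χ : Coloring n) → e (R χ) ≡ e S → e S < e (B χ)
  e[S]<other χ eR≡eS = ≰⇒> λ eB≤eS → <-irrefl refl (begin-strict
    2 * (n * p + p * d)        <⟨ twice-bound<pairs ⟩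
    n * (p + d)                ≡⟨ size-R+B {p + d} χ ⟨
    2 * (e (R χ) + e (B χ))    ≤⟨ *-monoʳ-≤ 2 (+-mono-≤ (≤-reflexive eR≡eS) eB≤eS) ⟩
    2 * (e S + e S)            ≡⟨ cong (2 *_) (trans (sym (2*m≡m+m (e S))) 2*e[S]) ⟩
    2 * (n * p + p * d)        ∎)
    where open ≤-Reasoning

  minColor-≅ : ∀ (χ : Coloring n) → R χ ≅ S → minColor χ ≡ e S
  minColor-≅ χ iso = ⊓-≡ˡ eR (<⇒≤ (e[S]<other χ eR))
    where
    eR : e (R χ) ≡ e S
    eR = e-≅ (R χ) S iso

  -- Outside the clique the red degree is p < m. Inside it the red degree is n - 1, which leaves no
  -- blue edge.
  ≅⇒unbalanced : ∀ (χ : Coloring n) → R χ ≅ S → Unbalanced m χ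
  ≅⇒unbalanced χ iso@(π , _) v (m≤R , m≤B) =
    absurd (initial (π ⟨$⟩ʳ v)) (trans (deg-≅ (R χ) S iso v) (deg-split initial count-initial≡p (π ⟨$⟩ʳ v)))
    where
    open ≤-Reasoning
    absurd : ∀ b → deg (R χ) v ≡ p + 𝟙 b * d → ⊥
    absurd false degR = <-irrefl refl (≤-trans m≤R (≤-reflexive (trans degR (+-identityʳ p))))
    absurd true  degR = <-irrefl refl (begin-strict
      p + d                        <⟨ n<1+n _ ⟩
      suc (p + d)                  ≡⟨ +-comm 1 (p + d) ⟩
      p + d + 1                    ≡⟨ cong (λ x → p + x + 1) (+-identityʳ d) ⟨
      p + 1 * d + 1                ≤⟨ +-mono-≤ (≤-reflexive (sym degR)) (≤-trans (s≤s z≤n) m≤B) ⟩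
      deg (R χ) v + deg (B χ) v    ≡⟨ deg-R+B χ v ⟩
      p + d                        ∎)

  unbalanced⇒minColor≤ : ∀ (χ : Coloring n) → Unbalanced m χ → minColor χ ≤ e S
  unbalanced⇒minColor≤ χ unbal =
    [ (λ bR → ≤-trans (m⊓n≤m (e (R χ)) (e (B χ))) (degreeBounded⇒size≤ (R χ) bR))
    , (λ bB → ≤-trans (m⊓n≤n (e (R χ)) (e (B χ))) (degreeBounded⇒size≤ (B χ) bB)) ]′
      (unbalanced⇒degreeBounded χ unbal)

  unbalanced⇒≅ : ∀ (χ : Coloring n) → e S ≤ minColor χ → Unbalanced m χ → R χ ≅ S ⊎ B χ ≅ S
  unbalanced⇒≅ χ eS≤ unbal = map
    (λ bR → extremal⇒≅ (R χ) bR (≤-trans eS≤ (m⊓n≤m (e (R χ)) (e (B χ)))))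
    (λ bB → extremal⇒≅ (B χ) bB (≤-trans eS≤ (m⊓n≤n (e (R χ)) (e (B χ)))))
    (unbalanced⇒degreeBounded χ unbal)

  ≅⊎≅⇒unbalanced : ∀ (χ : Coloring n) → R χ ≅ S ⊎ B χ ≅ S → Unbalanced m χ
  ≅⊎≅⇒unbalanced χ (inj₁ iso) = ≅⇒unbalanced χ iso
  ≅⊎≅⇒unbalanced χ (inj₂ iso) v (m≤R , m≤B) = ≅⇒unbalanced (swapColors χ) iso v (m≤B , m≤R)

  isBal : IsBal n (star (m + m)) (e S)
  isBal = forces , least
    where
    forces : ForcesBalanced n (star (m + m)) (e S)
    forces χ eS< =
      [ id , (λ unbal → contradiction (unbalanced⇒minColor≤ χ unbal) (<⇒≱ eS<)) ]′ (balancedStar⊎unbalanced m χ)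
    -- Coloring `S` red and the rest blue gives minimum e(S) without a balanced star, so no smaller
    -- threshold can force one.
    χ₀ : Coloring n
    χ₀ = redGraph S
    least : ∀ s → ForcesBalanced n (star (m + m)) s → e S ≤ s
    least s force = ≮⇒≥ λ s<eS → unbalanced⇒¬balancedStar χ₀ (≅⇒unbalanced χ₀ (≅-refl S))
      (force χ₀ (≤-trans s<eS (≤-reflexive (sym (minColor-≅ χ₀ (≅-refl S))))))

  isBalFamily : IsBalFamily (star (m + m)) (e S) (_≅ S)
  isBalFamily = record
    { closed        = λ H H′ H≅H′ H≅S → ≅-trans H′ H S (≅-sym H H′ H≅H′) H≅S
    ; size          = λ H → e-≅ H S
    ; characterizes = λ χ min≡ → mk⇔
        (λ ¬copy → S , ≅-refl S ,
          unbalanced⇒≅ χ (≤-reflexive (sym min≡)) (¬balancedStar⇒unbalanced χ ¬copy))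
        (λ { (H , H≅S , inj₁ R≅H) → unbalanced⇒¬balancedStar χ
               (≅⊎≅⇒unbalanced χ (inj₁ (≅-trans (R χ) H S R≅H H≅S)))
           ; (H , H≅S , inj₂ B≅H) → unbalanced⇒¬balancedStar χ
               (≅⊎≅⇒unbalanced χ (inj₂ (≅-trans (B χ) H S B≅H H≅S))) }) }

  -- Any candidate `H` is tested on the coloring with `H` red. Its blue graph has more than e(S)
  -- edges, so the alternatives about blue drop out and the characterization speaks of `H` alone.
  isBalFamily-unique : (F : Pred (Graph n) 0ℓ) → IsBalFamily (star (m + m)) (e S) F → ∀ H → F H ⇔ H ≅ S
  isBalFamily-unique F family H = mk⇔ F⇒≅ ≅⇒F
    where
    open IsBalFamily family
    open Equivalence using (to; from)
    χ : Coloring n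
    χ = redGraph H
    ¬B≅ : e H ≡ e S → ∀ H′ → e H′ ≡ e S → ¬ (B χ ≅ H′)
    ¬B≅ eH H′ eH′ iso = <-irrefl (sym (trans (e-≅ (B χ) H′ iso) eH′)) (e[S]<other χ eH)
    F⇒≅ : F H → H ≅ S
    F⇒≅ FH =
      [ id , (λ B≅S → contradiction B≅S (¬B≅ (size H FH) S refl)) ]′
        (unbalanced⇒≅ χ (≤-reflexive (sym min≡))
          (¬balancedStar⇒unbalanced χ (from (characterizes χ min≡) (H , FH , inj₁ (≅-refl H)))))
      where
      min≡ : minColor χ ≡ e S
      min≡ = ⊓-≡ˡ (size H FH) (<⇒≤ (e[S]<other χ (size H FH)))
    ≅⇒F : H ≅ S → F H
    ≅⇒F H≅S = conclude (to (characterizes χ (minColor-≅ χ H≅S))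
                            (unbalanced⇒¬balancedStar χ (≅⇒unbalanced χ H≅S)))
      where
      conclude : ∃[ H′ ] F H′ × (H ≅ H′ ⊎ B χ ≅ H′) → F H
      conclude (H′ , FH′ , inj₁ H≅H′) = closed H′ H (≅-sym H H′ H≅H′) FH′
      conclude (H′ , FH′ , inj₂ B≅H′) = contradiction B≅H′ (¬B≅ (e-≅ H S H≅S) H′ (size H′ FH′))

-- The numerical form of the value

-- Normalized fractions with variable numerators are stuck on a gcd. In `ℚᵘ` equality is a
-- cross-multiplied identity of integers, which a ring solver can prove.
toℚᵘ-/ : ∀ i d → ℚ.toℚᵘ (i ℚ./ suc d) ℚᵘ.≃ mkℚᵘ i d
toℚᵘ-/ i d = ℚₚ.toℚᵘ-fromℚᵘ (mkℚᵘ i d)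

toℚᵘ-+ : ∀ x y {x′ y′} → ℚ.toℚᵘ x ℚᵘ.≃ x′ → ℚ.toℚᵘ y ℚᵘ.≃ y′ → ℚ.toℚᵘ (x ℚ.+ y) ℚᵘ.≃ x′ ℚᵘ.+ y′
toℚᵘ-+ x y p q = ℚᵘₚ.≃-trans (ℚₚ.toℚᵘ-homo-+ x y) (ℚᵘₚ.+-cong p q)

toℚᵘ-* : ∀ x y {x′ y′} → ℚ.toℚᵘ x ℚᵘ.≃ x′ → ℚ.toℚᵘ y ℚᵘ.≃ y′ → ℚ.toℚᵘ (x ℚ.* y) ℚᵘ.≃ x′ ℚᵘ.* y′
toℚᵘ-* x y p q = ℚᵘₚ.≃-trans (ℚₚ.toℚᵘ-homo-* x y) (ℚᵘₚ.*-cong p q)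

toℚᵘ-neg : ∀ x {x′} → ℚ.toℚᵘ x ℚᵘ.≃ x′ → ℚ.toℚᵘ (ℚ.- x) ℚᵘ.≃ ℚᵘ.- x′
toℚᵘ-neg x p = ℚᵘₚ.≃-trans (ℚₚ.toℚᵘ-homo‿- x) (ℚᵘₚ.-‿cong p)

toℚᵘ-rhs : ∀ k n k² → ℚ.toℚᵘ ((((k ℚ./ 1 ℚ.- + 2 ℚ./ 1) ℚ.* ℚ.½) ℚ.* (n ℚ./ 1) ℚ.- k² ℚ./ 8) ℚ.+ k ℚ./ 4)
  ℚᵘ.≃ (((mkℚᵘ k 0 ℚᵘ.- mkℚᵘ (+ 2) 0) ℚᵘ.* ℚᵘ.½) ℚᵘ.* mkℚᵘ n 0 ℚᵘ.- mkℚᵘ k² 7) ℚᵘ.+ mkℚᵘ k 3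
toℚᵘ-rhs k n k² = toℚᵘ-+ (((k ℚ./ 1 ℚ.- + 2 ℚ./ 1) ℚ.* ℚ.½) ℚ.* (n ℚ./ 1) ℚ.- k² ℚ./ 8) (k ℚ./ 4)
    (toℚᵘ-+ (((k ℚ./ 1 ℚ.- + 2 ℚ./ 1) ℚ.* ℚ.½) ℚ.* (n ℚ./ 1)) (ℚ.- (k² ℚ./ 8))
      (toℚᵘ-* ((k ℚ./ 1 ℚ.- + 2 ℚ./ 1) ℚ.* ℚ.½) (n ℚ./ 1)
        (toℚᵘ-* (k ℚ./ 1 ℚ.- + 2 ℚ./ 1) ℚ.½
          (toℚᵘ-+ (k ℚ./ 1) (ℚ.- (+ 2 ℚ./ 1)) (toℚᵘ-/ k 0) ℚᵘₚ.≃-refl)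
          ℚᵘₚ.≃-refl)
        (toℚᵘ-/ n 0))
      (toℚᵘ-neg (k² ℚ./ 8) (toℚᵘ-/ k² 7)))
    (toℚᵘ-/ k 3)

-- With d = n - p - 1 the hypothesis gives b = p n - p (p + 1) / 2, and the right side reduces to
-- the same for k = 2 p + 2.
rational-value : ∀ p d b → 2 * b ≡ suc (p + d) * p + p * d → let k = suc p + suc p; n = suc (p + d) in
  + b ℚ./ 1 ≡ (((+ k ℚ./ 1 ℚ.- + 2 ℚ./ 1) ℚ.* ℚ.½) ℚ.* (+ n ℚ./ 1) ℚ.- + (k ^ 2) ℚ./ 8) ℚ.+ + k ℚ./ 4
rational-value p d b 2b≡ = ℚₚ.toℚᵘ-injective
  (ℚᵘₚ.≃-trans (toℚᵘ-/ (+ b) 0) (ℚᵘₚ.≃-trans (*≡* cross-multiplied) (ℚᵘₚ.≃-sym (toℚᵘ-rhs (+ k) (+ n) (+ (k ^ 2))))))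
  where
  open ≡-Reasoning
  k n : ℕ
  k = suc p + suc p
  n = suc (p + d)
  K² : + (k ^ 2) ≡ + k ℤ.* + k
  K² = trans (ℤₚ.pos-* k (k * 1)) (cong (λ x → + k ℤ.* + x) (*-identityʳ k))
  2B : + 2 ℤ.* + b ≡ + n ℤ.* + p ℤ.+ + p ℤ.* + d
  2B = begin
    + 2 ℤ.* + b                      ≡⟨ ℤₚ.pos-* 2 b ⟨
    + (2 * b)                        ≡⟨ cong +_ 2b≡ ⟩
    + (n * p) ℤ.+ + (p * d)          ≡⟨ cong₂ ℤ._+_ (ℤₚ.pos-* n p) (ℤₚ.pos-* p d) ⟩
    + n ℤ.* + p ℤ.+ + p ℤ.* + d      ∎
  -- The right side has denominator 64 = 2 * 8 * 4; one factor 2 is split off to match `2B`.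
  double : ∀ B → B ℤ.* + 64 ≡ + 32 ℤ.* (+ 2 ℤ.* B)
  double = ℤ-RingSolver.solve-∀
  -- The constant factors are the denominators that ℚᵘ accumulates without cancelling.
  identity : ∀ P D → + 32 ℤ.* ((+ 1 ℤ.+ (P ℤ.+ D)) ℤ.* P ℤ.+ P ℤ.* D) ≡
    ((((((+ 1 ℤ.+ P ℤ.+ (+ 1 ℤ.+ P)) ℤ.* + 1 ℤ.+ ℤ.- + 2 ℤ.* + 1) ℤ.* + 1) ℤ.* (+ 1 ℤ.+ (P ℤ.+ D))) ℤ.* + 8
      ℤ.+ (ℤ.- ((+ 1 ℤ.+ P ℤ.+ (+ 1 ℤ.+ P)) ℤ.* (+ 1 ℤ.+ P ℤ.+ (+ 1 ℤ.+ P)))) ℤ.* + 2) ℤ.* + 4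
      ℤ.+ (+ 1 ℤ.+ P ℤ.+ (+ 1 ℤ.+ P)) ℤ.* + 16) ℤ.* + 1
  identity = ℤ-RingSolver.solve-∀
  -- The square is an argument so that `k ^ 2` can be exchanged for the product occurring in
  -- `identity`.
  numerator : ℤ.ℤ → ℤ.ℤ
  numerator k² = (((((+ k ℤ.* + 1 ℤ.+ ℤ.- + 2 ℤ.* + 1) ℤ.* + 1) ℤ.* + n) ℤ.* + 8
    ℤ.+ (ℤ.- k²) ℤ.* + 2) ℤ.* + 4 ℤ.+ + k ℤ.* + 16) ℤ.* + 1
  cross-multiplied : + b ℤ.* + 64 ≡ numerator (+ (k ^ 2))
  cross-multiplied = begin
    + b ℤ.* + 64                              ≡⟨ double (+ b) ⟩
    + 32 ℤ.* (+ 2 ℤ.* + b)                    ≡⟨ cong (+ 32 ℤ.*_) 2B ⟩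
    + 32 ℤ.* (+ n ℤ.* + p ℤ.+ + p ℤ.* + d)    ≡⟨ identity (+ p) (+ d) ⟩
    numerator (+ k ℤ.* + k)                   ≡⟨ cong numerator K² ⟨
    numerator (+ (k ^ 2))                     ∎

even≥2 : ∀ {k} → k ≥ 2 → 2 ∣ k → ∃[ p ] k ≡ suc p + suc p
even≥2 () (divides zero refl)
even≥2 _  (divides (suc p) refl) = p , double p
  where
  double : ∀ p → suc p * 2 ≡ suc p + suc p
  double = solve-∀

[m+m]^2/4 : ∀ m → (m + m) ^ 2 / 4 ≡ m * m
[m+m]^2/4 m = trans (cong (_/ 4) (square m)) (m*n/n≡m (m * m) 4)
  where
  square : ∀ m → (m + m) * ((m + m) * 1) ≡ m * m * 4
  square = solve-∀

[m+m∸2]/2 : ∀ p → (suc p + suc p ∸ 2) / 2 ≡ p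
-- One subtraction is done by computation; `odd` exposes the successor that the other one removes.
[m+m∸2]/2 p = trans (cong (λ x → (x ∸ 1) / 2) (odd p)) (m*n/n≡m p 2)
  where
  odd : ∀ p → p + (1 + p) ≡ 1 + p * 2
  odd = solve-∀

-- Since k is even, k² / 4 is exactly m², and d = n - m is the witness.
large-order : ∀ p n → n ≥ (suc p + suc p) ^ 2 / 4 + 1 → ∃[ d ] suc (p * p + p) ≤ d × suc (p + d) ≡ n
large-order p n n≥ = n ∸ suc p , +-cancelˡ-≤ (suc p) _ _ (≤-trans bound (≤-reflexive (sym eq))) , eq
  where
  open ≤-Reasoning
  expand : ∀ p → suc p + (1 + (p * p + p)) ≡ suc p * suc p + 1
  expand = solve-∀
  bound : suc p + suc (p * p + p) ≤ n
  bound = begin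
    suc p + suc (p * p + p)            ≡⟨ expand p ⟩
    suc p * suc p + 1                  ≡⟨ cong (_+ 1) ([m+m]^2/4 (suc p)) ⟨
    (suc p + suc p) ^ 2 / 4 + 1        ≤⟨ n≥ ⟩
    n                                  ∎
  eq : suc (p + (n ∸ suc p)) ≡ n
  eq = m+[n∸m]≡n (≤-trans (m≤m+n (suc p) _) bound)

theorem3p2 : ∀ (k n : ℕ) → k ≥ 2 → 2 ∣ k → n ≥ 3 ⊔ (k ^ 2 / 4 + 1) →
    Σ[ b ∈ ℕ ]
      IsBal n (star k) b ×
      (+ b ℚ./ 1 ≡ (((+ k ℚ./ 1 ℚ.- + 2 ℚ./ 1) ℚ.* ℚ.½) ℚ.* (+ n ℚ./ 1)
                    ℚ.- + (k ^ 2) ℚ./ 8) ℚ.+ + k ℚ./ 4) ×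
      (Σ[ S ∈ Graph n ]
        IsCompleteSplit ((k ∸ 2) / 2) (n ∸ (k ∸ 2) / 2) S ×
        IsBalFamily (star k) b (λ H → H ≅ S) ×
        ((F : Pred (Graph n) 0ℓ) → IsBalFamily (star k) b F → ∀ H → F H ⇔ H ≅ S))
-- Matching both equations with `refl` turns k into `suc p + suc p` and n into `suc (p + d)`, the
-- form in which `Extremal` states its results.
theorem3p2 k n k≥2 2∣k n≥ with even≥2 k≥2 2∣k
... | p , refl with large-order p n (m⊔n≤o⇒n≤o 3 _ n≥)
...   | d , large , refl =
  e S , isBal , rational-value p d (e S) 2*e[S] ,
  S , S-isCompleteSplit , isBalFamily , isBalFamily-unique
  where
  open Extremal p d large using (S; initial; count-initial≡p; isBal; 2*e[S]; isBalFamily; isBalFamily-unique)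
  S-isCompleteSplit : IsCompleteSplit ((suc p + suc p ∸ 2) / 2) (suc (p + d) ∸ (suc p + suc p ∸ 2) / 2) S
  S-isCompleteSplit = subst (λ x → IsCompleteSplit x (suc (p + d) ∸ x) S)
    (trans count-initial≡p (sym ([m+m∸2]/2 p))) (split-isCompleteSplit initial)
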